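{- The structure $(B_\infty,T,\cdot,\equiv,1,\sigma_1,\sigma_1^{ -1})$ is a canonical model for the link axioms. That is: (i) it satisfies the link axioms; (ii) every element of $B_\infty$ is the interpretation of a closed term of the language (built from $1,\sigma,\bar\sigma$ using $\cdot$ and $T$); (iii) for every structure $(S,T_1,*,\equiv',1',\sigma_1',\bar\sigma_1')$ satisfying the link axioms there is a unique homomorphism of structures $f:B_\infty\to S$, i.e. a unique map with $f(1)=1'$, $f(\sigma_1)=\sigma_1'$, $f(\sigma_1^{ -1})=\bar\sigma_1'$, $f(x\cdot y)=f(x)*f(y)$, $f(T(x))=T_1(f(x))$ for all $x,y$, and $x\equiv y\Rightarrow f(x)\equiv' f(y)$.
   Context: Consider a first-order language (with equality) with signature $(\cdot,T,\equiv,1,\sigma,\bar\sigma)$: $\cdot$ binary function, $T$ unary function, $\equiv$ binary predicate, constants $1,\sigma,\bar\sigma$. The link axioms are: $\forall x,y,z\ x\cdot(y\cdot z)=(x\cdot y)\cdot z$; $\forall x\ 1\cdot x=x$; $\forall x\ x\cdot 1=x$; $\sigma\cdot\bar\sigma=\bar\sigma\cdot\sigma=1$; $\forall x,y\ T(x\cdot y)=T(x)\cdot T(y)$; $T(1)=1$; $\sigma\cdot T(\sigma)\cdot\sigma=T(\sigma)\cdot\sigma\cdot T(\sigma)$; $\forall b\ \sigma\cdot T(T(b))=T(T(b))\cdot\sigma$; $\equiv$ is reflexive, symmetric and transitive; $\forall x,y,z\ (y\cdot z=1\to x\equiv y\cdot x\cdot z)$; $\forall x\ x\equiv\sigma\cdot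 T(x)$; $\forall x\ x\equiv\bar\sigma\cdot T(x)$. $B_\infty$ is the group generated by $\{\sigma_i\}_{i\in\mathbb{N}}$ with relations $\sigma_i\sigma_j=\sigma_j\sigma_i$ for $i\ge j+2$ and $\sigma_i\sigma_{i+1}\sigma_i=\sigma_{i+1}\sigma_i\sigma_{i+1}$; $T$ is the homomorphism of $B_\infty$ with $T(\sigma_i)=\sigma_{i+1}$; $\cdot$ is the group multiplication, $1$ the identity, and $\sigma,\bar\sigma$ are interpreted as $\sigma_1,\sigma_1^{ -1}$; $\equiv$ on $B_\infty$ is the equivalence relation generated by $aba^{ -1}\equiv b$, $b\equiv\sigma_1T(b)$, $b\equiv\sigma_1^{ -1}T(b)$ for all $a,b\in B_\infty$. -}

module Defs where

open import Algebra.Bundles using (Group)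
open import Data.Nat.Base using (ℕ; suc; _+_; _≤_; s≤s)
open import Level using (Level; _⊔_; 0ℓ) renaming (suc to lsuc)
open import Relation.Binary.Core using (Rel)
open import Relation.Binary.Structures using (IsEquivalence)
open import Relation.Binary.Construct.Closure.Equivalence using (EqClosure)
import Relation.Binary.Construct.Closure.Equivalence as EqC

-- Structures for the signature (·, T, ≡, 1, σ, σ̄).  The equality symbol of the
-- language is interpreted by the setoid equality _≈_, which all symbols respect;
-- the predicate symbol ≡ of the language is written _∼_.
record Structure (c ℓ₁ ℓ₂ : Level) : Set (lsuc (c ⊔ ℓ₁ ⊔ ℓ₂)) where
  infixl 7 _·_
  infix  4 _≈_ _∼_
  field
    Carrier       : Set c
    _≈_           : Rel Carrier ℓ₁
    isEquivalence : IsEquivalence _≈_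
    _·_           : Carrier → Carrier → Carrier
    T             : Carrier → Carrier
    _∼_           : Rel Carrier ℓ₂
    𝟙 σ σ̄         : Carrier
    ·-cong        : ∀ {x x′ y y′} → x ≈ x′ → y ≈ y′ → x · y ≈ x′ · y′
    T-cong        : ∀ {x x′} → x ≈ x′ → T x ≈ T x′
    ∼-resp-≈      : ∀ {x x′ y y′} → x ≈ x′ → y ≈ y′ → x ∼ y → x′ ∼ y′

record LinkAxioms {c ℓ₁ ℓ₂ : Level} (S : Structure c ℓ₁ ℓ₂) : Set (c ⊔ ℓ₁ ⊔ ℓ₂) where
  open Structure S
  field
    assoc           : ∀ x y z → x · (y · z) ≈ (x · y) · z
    identityˡ       : ∀ x → 𝟙 · x ≈ x
    identityʳ       : ∀ x → x · 𝟙 ≈ x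
    σ·σ̄             : σ · σ̄ ≈ 𝟙
    σ̄·σ             : σ̄ · σ ≈ 𝟙
    T-·             : ∀ x y → T (x · y) ≈ T x · T y
    T-𝟙             : T 𝟙 ≈ 𝟙
    braid           : σ · T σ · σ ≈ T σ · σ · T σ
    far             : ∀ b → σ · T (T b) ≈ T (T b) · σ
    ∼-isEquivalence : IsEquivalence _∼_
    ∼-conj          : ∀ x y z → y · z ≈ 𝟙 → x ∼ y · x · z
    ∼-σ             : ∀ x → x ∼ σ · T x
    ∼-σ̄             : ∀ x → x ∼ σ̄ · T x

data ClosedTerm : Set where
  _·ᵗ_     : ClosedTerm → ClosedTerm → ClosedTerm
  Tᵗ       : ClosedTerm → ClosedTerm
  𝟙ᵗ σᵗ σ̄ᵗ : ClosedTerm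

module _ {c ℓ₁ ℓ₂ : Level} (S : Structure c ℓ₁ ℓ₂) where
  open Structure S

  interpret : ClosedTerm → Carrier
  interpret (s ·ᵗ t) = interpret s · interpret t
  interpret (Tᵗ t)   = T (interpret t)
  interpret 𝟙ᵗ       = 𝟙
  interpret σᵗ       = σ
  interpret σ̄ᵗ       = σ̄

record IsHomomorphism {c ℓ₁ ℓ₂ c′ ℓ₁′ ℓ₂′ : Level}
                      (M : Structure c ℓ₁ ℓ₂) (N : Structure c′ ℓ₁′ ℓ₂′)
                      (f : Structure.Carrier M → Structure.Carrier N)
                      : Set (c ⊔ ℓ₁ ⊔ ℓ₂ ⊔ ℓ₁′ ⊔ ℓ₂′) where
  private
    module M = Structure M
    module N = Structure N
  field
    cong   : ∀ {x y} → x M.≈ y → f x N.≈ f y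
    𝟙-homo : f M.𝟙 N.≈ N.𝟙
    σ-homo : f M.σ N.≈ N.σ
    σ̄-homo : f M.σ̄ N.≈ N.σ̄
    ·-homo : ∀ x y → f (x M.· y) N.≈ f x N.· f y
    T-homo : ∀ x → f (M.T x) N.≈ N.T (f x)
    ∼-homo : ∀ {x y} → x M.∼ y → f x N.∼ f y

-- The group B∞ as group words in the generators, modulo the least congruence
-- containing the group laws and the braid relations.

infixl 7 _∙_
infix  8 _⁻¹
infix  4 _≈ᴮ_ _∼ᴮ_

-- Generators are numbered from 0 here: gen i is σ_{i+1}, so gen 0 is σ₁.
data Word : Set where
  gen : ℕ → Word
  ε   : Word
  _∙_ : Word → Word → Word
  _⁻¹ : Word → Word

data _≈ᴮ_ : Rel Word 0ℓ where
  refl  : ∀ {x} → x ≈ᴮ x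
  sym   : ∀ {x y} → x ≈ᴮ y → y ≈ᴮ x
  trans : ∀ {x y z} → x ≈ᴮ y → y ≈ᴮ z → x ≈ᴮ z

  ∙-cong  : ∀ {x x′ y y′} → x ≈ᴮ x′ → y ≈ᴮ y′ → x ∙ y ≈ᴮ x′ ∙ y′
  ⁻¹-cong : ∀ {x x′} → x ≈ᴮ x′ → x ⁻¹ ≈ᴮ x′ ⁻¹

  assoc     : ∀ x y z → (x ∙ y) ∙ z ≈ᴮ x ∙ (y ∙ z)
  identityˡ : ∀ x → ε ∙ x ≈ᴮ x
  identityʳ : ∀ x → x ∙ ε ≈ᴮ x
  inverseˡ  : ∀ x → x ⁻¹ ∙ x ≈ᴮ ε
  inverseʳ  : ∀ x → x ∙ x ⁻¹ ≈ᴮ ε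

  far   : ∀ i j → j + 2 ≤ i → gen i ∙ gen j ≈ᴮ gen j ∙ gen i
  braid : ∀ i → gen i ∙ gen (suc i) ∙ gen i ≈ᴮ gen (suc i) ∙ gen i ∙ gen (suc i)

≈ᴮ-isEquivalence : IsEquivalence _≈ᴮ_
≈ᴮ-isEquivalence = record { refl = refl ; sym = sym ; trans = trans }

B∞-group : Group 0ℓ 0ℓ
B∞-group = record
  { Carrier = Word
  ; _≈_     = _≈ᴮ_
  ; _∙_     = _∙_
  ; ε       = ε
  ; _⁻¹     = _⁻¹
  ; isGroup = record
    { isMonoid = record
      { isSemigroup = record
        { isMagma = record { isEquivalence = ≈ᴮ-isEquivalence ; ∙-cong = ∙-cong }
        ; assoc   = assoc
        }
      ; identity = record { fst = identityˡ ; snd = identityʳ }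
      }
    ; inverse = record { fst = inverseˡ ; snd = inverseʳ }
    ; ⁻¹-cong = ⁻¹-cong
    }
  }

shift : Word → Word
shift (gen i) = gen (suc i)
shift ε       = ε
shift (x ∙ y) = shift x ∙ shift y
shift (x ⁻¹)  = shift x ⁻¹

shift-cong : ∀ {x y} → x ≈ᴮ y → shift x ≈ᴮ shift y
shift-cong refl            = refl
shift-cong (sym p)         = sym (shift-cong p)
shift-cong (trans p q)     = trans (shift-cong p) (shift-cong q)
shift-cong (∙-cong p q)    = ∙-cong (shift-cong p) (shift-cong q)
shift-cong (⁻¹-cong p)     = ⁻¹-cong (shift-cong p)
shift-cong (assoc x y z)   = assoc (shift x) (shift y) (shift z)
shift-cong (identityˡ x)   = identityˡ (shift x)
shift-cong (identityʳ x)   = identityʳ (shift x)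
shift-cong (inverseˡ x)    = inverseˡ (shift x)
shift-cong (inverseʳ x)    = inverseʳ (shift x)
shift-cong (far i j j+2≤i) = far (suc i) (suc j) (s≤s j+2≤i)
shift-cong (braid i)       = braid (suc i)

-- Elements of B∞ are words up to _≈ᴮ_, so a relation on B∞ has to relate equal
-- words; the constructor `equal` is there for this reason only.
data LinkMove : Rel Word 0ℓ where
  equal : ∀ {a b} → a ≈ᴮ b → LinkMove a b
  conj  : ∀ a b → LinkMove (a ∙ b ∙ a ⁻¹) b
  stab⁺ : ∀ b → LinkMove b (gen 0 ∙ shift b)
  stab⁻ : ∀ b → LinkMove b (gen 0 ⁻¹ ∙ shift b)

_∼ᴮ_ : Rel Word 0ℓ
_∼ᴮ_ = EqClosure LinkMove

∼ᴮ-resp-≈ᴮ : ∀ {x x′ y y′} → x ≈ᴮ x′ → y ≈ᴮ y′ → x ∼ᴮ y → x′ ∼ᴮ y′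
∼ᴮ-resp-≈ᴮ p q r =
  EqC.transitive LinkMove (EqC.return (equal (sym p)))
    (EqC.transitive LinkMove r (EqC.return (equal q)))

B∞ : Structure 0ℓ 0ℓ 0ℓ
B∞ = record
  { Carrier       = Word
  ; _≈_           = _≈ᴮ_
  ; isEquivalence = ≈ᴮ-isEquivalence
  ; _·_           = _∙_
  ; T             = shift
  ; _∼_           = _∼ᴮ_
  ; 𝟙             = ε
  ; σ             = gen 0
  ; σ̄             = gen 0 ⁻¹
  ; ·-cong        = ∙-cong
  ; T-cong        = shift-cong
  ; ∼-resp-≈      = ∼ᴮ-resp-≈ᴮ
  }

{-# OPTIONS --safe #-}

-- Inverses are pushed down to the generators, so that every word x acquires a closed
-- term naming it and a closed term naming its inverse.  In a model S of the link axioms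
-- these two terms are interpreted by mutually inverse elements; hence evaluating the
-- term of x in S respects the group laws, and it respects the braid relations because
-- these are the images under powers of T of the braid and far axioms.  Any homomorphism
-- commutes with the interpretation of closed terms, which gives uniqueness.
module Submission where

open import Defs
open import Level using (Level)
open import Data.Product using (_×_; ∃; ∃!; _,_)
open import Algebra.Bundles using (Group; Monoid)
open import Data.Nat.Base using (zero; suc; _+_; _≤_; z≤n; s≤s)
open import Function.Base using (_∘_)
open import Relation.Binary.Structures using (IsEquivalence)
import Algebra.Properties.Group
import Algebra.Properties.Monoid
import Relation.Binary.Construct.Closure.Equivalence as EqC
import Relation.Binary.Reasoning.Setoid as SetoidReasoning

module B∞-Properties = Algebra.Properties.Group B∞-group

module _ {c ℓ : Level} (M : Monoid c ℓ) where
  open Monoid M using (_≈_) renaming (_∙_ to _·_; ε to 𝟙; trans to ≈-trans)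
  open Algebra.Properties.Monoid M

  -- Both sides equal `y · x · z`.
  inverse-unique : ∀ {x y z} → y · x ≈ 𝟙 → x · z ≈ 𝟙 → y ≈ z
  inverse-unique yx≈𝟙 xz≈𝟙 = ≈-trans (insertʳ xz≈𝟙 _) (elimˡ yx≈𝟙 _)

  inverse-∙ : ∀ {x x′ y y′} → x · x′ ≈ 𝟙 → y · y′ ≈ 𝟙 → (x · y) · (y′ · x′) ≈ 𝟙
  inverse-∙ xx′≈𝟙 yy′≈𝟙 = ≈-trans (cancelᶜ yy′≈𝟙 _ _) xx′≈𝟙

open SetoidReasoning (Group.setoid B∞-group)

-- The elements commuting with `gen 0` form a subgroup, and on a generator the claim is a far
-- relation; hence the induction on words.
σ₁-commutes-shift² : ∀ b → gen 0 ∙ shift (shift b) ≈ᴮ shift (shift b) ∙ gen 0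
σ₁-commutes-shift² (gen i) = sym (far (2 + i) 0 (s≤s (s≤s z≤n)))
σ₁-commutes-shift² ε       = trans (identityʳ _) (sym (identityˡ _))
σ₁-commutes-shift² (x ∙ y) = begin
  s ∙ (x″ ∙ y″)  ≈⟨ assoc s x″ y″ ⟨
  s ∙ x″ ∙ y″    ≈⟨ ∙-cong (σ₁-commutes-shift² x) refl ⟩
  x″ ∙ s ∙ y″    ≈⟨ assoc x″ s y″ ⟩
  x″ ∙ (s ∙ y″)  ≈⟨ ∙-cong refl (σ₁-commutes-shift² y) ⟩
  x″ ∙ (y″ ∙ s)  ≈⟨ assoc x″ y″ s ⟨
  x″ ∙ y″ ∙ s    ∎
  where
  s  = gen 0
  x″ = shift (shift x)
  y″ = shift (shift y)
-- After left multiplication by `x″` both sides reduce to `s`, the first one by the induction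
-- hypothesis.
σ₁-commutes-shift² (x ⁻¹) = B∞-Properties.∙-cancelˡ x″ _ _ (begin
  x″ ∙ (s ∙ x″ ⁻¹)  ≈⟨ assoc x″ s (x″ ⁻¹) ⟨
  x″ ∙ s ∙ x″ ⁻¹    ≈⟨ ∙-cong (σ₁-commutes-shift² x) refl ⟨
  s ∙ x″ ∙ x″ ⁻¹    ≈⟨ B∞-Properties.//-rightDividesʳ x″ s ⟩
  s                 ≈⟨ B∞-Properties.\\-leftDividesˡ x″ s ⟨
  x″ ∙ (x″ ⁻¹ ∙ s)  ∎)
  where
  s  = gen 0
  x″ = shift (shift x)

B∞-∼-conj : ∀ x y z → y ∙ z ≈ᴮ ε → x ∼ᴮ y ∙ x ∙ z
B∞-∼-conj x y z yz≈ε = EqC.symmetric LinkMove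
  -- In a group the right inverse `z` can only be `y ⁻¹`, the case covered by `conj`.
  (∼ᴮ-resp-≈ᴮ (∙-cong refl (sym (B∞-Properties.inverseʳ-unique y z yz≈ε))) refl
    (EqC.return (conj y x)))

B∞-linkAxioms : LinkAxioms B∞
B∞-linkAxioms = record
  { assoc           = λ x y z → sym (assoc x y z)
  ; identityˡ       = identityˡ
  ; identityʳ       = identityʳ
  ; σ·σ̄             = inverseʳ (gen 0)
  ; σ̄·σ             = inverseˡ (gen 0)
  ; T-·             = λ _ _ → refl
  ; T-𝟙             = refl
  ; braid           = braid 0
  ; far             = σ₁-commutes-shift²
  ; ∼-isEquivalence = EqC.isEquivalence LinkMove
  ; ∼-conj          = B∞-∼-conj
  ; ∼-σ             = λ x → EqC.return (stab⁺ x)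
  ; ∼-σ̄             = λ x → EqC.return (stab⁻ x)
  }

mutual
  -- The language has no inverse symbol, only the constant `σ̄`. Carrying two terms along turns `⁻¹`
  -- into a swap of the two.
  term : Word → ClosedTerm
  term (gen zero)    = σᵗ
  term (gen (suc i)) = Tᵗ (term (gen i))
  term ε             = 𝟙ᵗ
  term (x ∙ y)       = term x ·ᵗ term y
  term (x ⁻¹)        = inverseTerm x

  inverseTerm : Word → ClosedTerm
  inverseTerm (gen zero)    = σ̄ᵗ
  inverseTerm (gen (suc i)) = Tᵗ (inverseTerm (gen i))
  inverseTerm ε             = 𝟙ᵗ
  inverseTerm (x ∙ y)       = inverseTerm y ·ᵗ inverseTerm x
  inverseTerm (x ⁻¹)        = term x

mutual
  interpret-term : ∀ x → interpret B∞ (term x) ≈ᴮ x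
  interpret-term (gen zero)    = refl
  interpret-term (gen (suc i)) = shift-cong (interpret-term (gen i))
  interpret-term ε             = refl
  interpret-term (x ∙ y)       = ∙-cong (interpret-term x) (interpret-term y)
  interpret-term (x ⁻¹)        = interpret-inverseTerm x

  interpret-inverseTerm : ∀ x → interpret B∞ (inverseTerm x) ≈ᴮ x ⁻¹
  interpret-inverseTerm (gen zero)    = refl
  interpret-inverseTerm (gen (suc i)) = shift-cong (interpret-inverseTerm (gen i))
  interpret-inverseTerm ε             = sym B∞-Properties.ε⁻¹≈ε
  interpret-inverseTerm (x ∙ y)       =
    trans (∙-cong (interpret-inverseTerm y) (interpret-inverseTerm x))
          (sym (B∞-Properties.⁻¹-anti-homo-∙ x y))
  interpret-inverseTerm (x ⁻¹)        =
    trans (interpret-term x) (sym (B∞-Properties.⁻¹-involutive x))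

module _ {c ℓ₁ ℓ₂ c′ ℓ₁′ ℓ₂′ : Level}
         {M : Structure c ℓ₁ ℓ₂} {N : Structure c′ ℓ₁′ ℓ₂′}
         {f : Structure.Carrier M → Structure.Carrier N}
         (f-homo : IsHomomorphism M N f) where
  private
    module N = Structure N
    module f = IsHomomorphism f-homo
    open IsEquivalence N.isEquivalence renaming (trans to ≈-trans) using ()

  homo-interpret : ∀ t → f (interpret M t) N.≈ interpret N t
  homo-interpret (s ·ᵗ t) =
    ≈-trans (f.·-homo _ _) (N.·-cong (homo-interpret s) (homo-interpret t))
  homo-interpret (Tᵗ t)   = ≈-trans (f.T-homo _) (N.T-cong (homo-interpret t))
  homo-interpret 𝟙ᵗ       = f.𝟙-homo
  homo-interpret σᵗ       = f.σ-homo
  homo-interpret σ̄ᵗ       = f.σ̄-homo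

module Evaluation {c ℓ₁ ℓ₂ : Level} (S : Structure c ℓ₁ ℓ₂) (ax : LinkAxioms S) where
  open Structure S
  module Ax = LinkAxioms ax
  open IsEquivalence isEquivalence
    renaming (refl to ≈-refl; sym to ≈-sym; trans to ≈-trans) using ()
  open IsEquivalence Ax.∼-isEquivalence
    renaming (refl to ∼-refl; sym to ∼-sym) using ()

  monoid : Monoid c ℓ₁
  monoid = record
    { isMonoid = record
      { isSemigroup = record
        { isMagma = record { isEquivalence = isEquivalence ; ∙-cong = ·-cong }
        ; assoc   = λ x y z → ≈-sym (Ax.assoc x y z)
        }
      ; identity = Ax.identityˡ , Ax.identityʳ
      }
    }

  ⟦_⟧ : Word → Carrier
  ⟦_⟧ = interpret S ∘ term

  -- The carrier of `S` is only a monoid, so the inverse of `⟦ x ⟧` has to come from a term. By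
  -- definition it is also `⟦ x ⁻¹ ⟧`.
  ⟦_⟧⁻¹ : Word → Carrier
  ⟦_⟧⁻¹ = interpret S ∘ inverseTerm

  T-inverse : ∀ {x y} → x · y ≈ 𝟙 → T x · T y ≈ 𝟙
  T-inverse xy≈𝟙 = ≈-trans (≈-sym (Ax.T-· _ _)) (≈-trans (T-cong xy≈𝟙) Ax.T-𝟙)

  mutual
    ⟦⟧-inverseʳ : ∀ x → ⟦ x ⟧ · ⟦ x ⟧⁻¹ ≈ 𝟙
    ⟦⟧-inverseʳ (gen zero)    = Ax.σ·σ̄
    ⟦⟧-inverseʳ (gen (suc i)) = T-inverse (⟦⟧-inverseʳ (gen i))
    ⟦⟧-inverseʳ ε             = Ax.identityˡ 𝟙
    ⟦⟧-inverseʳ (x ∙ y)       = inverse-∙ monoid (⟦⟧-inverseʳ x) (⟦⟧-inverseʳ y)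
    ⟦⟧-inverseʳ (x ⁻¹)        = ⟦⟧-inverseˡ x

    ⟦⟧-inverseˡ : ∀ x → ⟦ x ⟧⁻¹ · ⟦ x ⟧ ≈ 𝟙
    ⟦⟧-inverseˡ (gen zero)    = Ax.σ̄·σ
    ⟦⟧-inverseˡ (gen (suc i)) = T-inverse (⟦⟧-inverseˡ (gen i))
    ⟦⟧-inverseˡ ε             = Ax.identityˡ 𝟙
    ⟦⟧-inverseˡ (x ∙ y)       = inverse-∙ monoid (⟦⟧-inverseˡ y) (⟦⟧-inverseˡ x)
    ⟦⟧-inverseˡ (x ⁻¹)        = ⟦⟧-inverseʳ x

  T-·₃ : ∀ x y z → T (x · y · z) ≈ T x · T y · T z
  T-·₃ x y z = ≈-trans (Ax.T-· _ _) (·-cong (Ax.T-· _ _) ≈-refl)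

  ⟦⟧-far : ∀ i j → j + 2 ≤ i → ⟦ gen i ⟧ · ⟦ gen j ⟧ ≈ ⟦ gen j ⟧ · ⟦ gen i ⟧
  -- Once the smaller index is 0, the bound makes the other at least 2, so its value is literally
  -- `T (T ⟦ gen i ⟧)`. Larger pairs descend to this one by stripping off `T`.
  ⟦⟧-far (suc (suc i)) zero    _               = ≈-sym (Ax.far ⟦ gen i ⟧)
  ⟦⟧-far (suc zero)    zero    (s≤s ())
  ⟦⟧-far (suc i)       (suc j) (s≤s j+2≤i) =
    ≈-trans (≈-sym (Ax.T-· _ _)) (≈-trans (T-cong (⟦⟧-far i j j+2≤i)) (Ax.T-· _ _))

  ⟦⟧-braid : ∀ i → ⟦ gen i ⟧ · ⟦ gen (suc i) ⟧ · ⟦ gen i ⟧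
                 ≈ ⟦ gen (suc i) ⟧ · ⟦ gen i ⟧ · ⟦ gen (suc i) ⟧
  ⟦⟧-braid zero    = Ax.braid
  ⟦⟧-braid (suc i) =
    ≈-trans (≈-sym (T-·₃ _ _ _)) (≈-trans (T-cong (⟦⟧-braid i)) (T-·₃ _ _ _))

  ⟦⟧-cong : ∀ {x y} → x ≈ᴮ y → ⟦ x ⟧ ≈ ⟦ y ⟧
  ⟦⟧-cong refl          = ≈-refl
  ⟦⟧-cong (sym p)       = ≈-sym (⟦⟧-cong p)
  ⟦⟧-cong (trans p q)   = ≈-trans (⟦⟧-cong p) (⟦⟧-cong q)
  ⟦⟧-cong (∙-cong p q)  = ·-cong (⟦⟧-cong p) (⟦⟧-cong q)
  -- No operation of `S` corresponds to `⁻¹`, so congruence is replaced by uniqueness: `⟦ x ⟧⁻¹` is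
  -- a left inverse and `⟦ y ⟧⁻¹` a right inverse of `⟦ x ⟧`.
  ⟦⟧-cong (⁻¹-cong {x} {y} p) = inverse-unique monoid (⟦⟧-inverseˡ x)
    (≈-trans (·-cong (⟦⟧-cong p) ≈-refl) (⟦⟧-inverseʳ y))
  ⟦⟧-cong (assoc x y z) = ≈-sym (Ax.assoc ⟦ x ⟧ ⟦ y ⟧ ⟦ z ⟧)
  ⟦⟧-cong (identityˡ x) = Ax.identityˡ ⟦ x ⟧
  ⟦⟧-cong (identityʳ x) = Ax.identityʳ ⟦ x ⟧
  ⟦⟧-cong (inverseˡ x)  = ⟦⟧-inverseˡ x
  ⟦⟧-cong (inverseʳ x)  = ⟦⟧-inverseʳ x
  ⟦⟧-cong (far i j p)   = ⟦⟧-far i j p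
  ⟦⟧-cong (braid i)     = ⟦⟧-braid i

  mutual
    -- Both `shift` and `T` are multiplicative, and on generators `term` was defined so that they
    -- agree.
    ⟦⟧-shift : ∀ x → ⟦ shift x ⟧ ≈ T ⟦ x ⟧
    ⟦⟧-shift (gen i) = ≈-refl
    ⟦⟧-shift ε       = ≈-sym Ax.T-𝟙
    ⟦⟧-shift (x ∙ y) = ≈-trans (·-cong (⟦⟧-shift x) (⟦⟧-shift y)) (≈-sym (Ax.T-· _ _))
    ⟦⟧-shift (x ⁻¹)  = ⟦⟧⁻¹-shift x

    ⟦⟧⁻¹-shift : ∀ x → ⟦ shift x ⟧⁻¹ ≈ T ⟦ x ⟧⁻¹
    ⟦⟧⁻¹-shift (gen i) = ≈-refl
    ⟦⟧⁻¹-shift ε       = ≈-sym Ax.T-𝟙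
    ⟦⟧⁻¹-shift (x ∙ y) = ≈-trans (·-cong (⟦⟧⁻¹-shift y) (⟦⟧⁻¹-shift x)) (≈-sym (Ax.T-· _ _))
    ⟦⟧⁻¹-shift (x ⁻¹)  = ⟦⟧-shift x

  ⟦⟧-linkMove : ∀ {x y} → LinkMove x y → ⟦ x ⟧ ∼ ⟦ y ⟧
  ⟦⟧-linkMove (equal p)  = ∼-resp-≈ ≈-refl (⟦⟧-cong p) ∼-refl
  -- The axiom conjugates by any element with a right inverse; here `⟦ a ⟧⁻¹` is that inverse.
  ⟦⟧-linkMove (conj a b) = ∼-sym (Ax.∼-conj ⟦ b ⟧ ⟦ a ⟧ ⟦ a ⟧⁻¹ (⟦⟧-inverseʳ a))
  ⟦⟧-linkMove (stab⁺ b)  =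
    ∼-resp-≈ ≈-refl (·-cong ≈-refl (≈-sym (⟦⟧-shift b))) (Ax.∼-σ ⟦ b ⟧)
  ⟦⟧-linkMove (stab⁻ b)  =
    ∼-resp-≈ ≈-refl (·-cong ≈-refl (≈-sym (⟦⟧-shift b))) (Ax.∼-σ̄ ⟦ b ⟧)

  ⟦⟧-isHomomorphism : IsHomomorphism B∞ S ⟦_⟧
  ⟦⟧-isHomomorphism = record
    { cong   = ⟦⟧-cong
    ; 𝟙-homo = ≈-refl
    ; σ-homo = ≈-refl
    ; σ̄-homo = ≈-refl
    ; ·-homo = λ _ _ → ≈-refl
    ; T-homo = ⟦⟧-shift
    -- Since `∼` on `S` is an equivalence, preserving the generating moves suffices.
    ; ∼-homo = EqC.gfold Ax.∼-isEquivalence ⟦_⟧ ⟦⟧-linkMove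
    }

  ⟦⟧-unique : ∀ {g} → IsHomomorphism B∞ S g → ∀ x → ⟦ x ⟧ ≈ g x
  ⟦⟧-unique g-homo x = ≈-trans (≈-sym (homo-interpret g-homo (term x)))
    (IsHomomorphism.cong g-homo (interpret-term x))

theorem6p4 : (c ℓ₁ ℓ₂ : Level) →
    LinkAxioms B∞
    × ((x : Structure.Carrier B∞) → ∃ λ (t : ClosedTerm) → Structure._≈_ B∞ (interpret B∞ t) x)
    × ((S : Structure c ℓ₁ ℓ₂) → LinkAxioms S →
    ∃! (λ (f g : Structure.Carrier B∞ → Structure.Carrier S) → ∀ x → Structure._≈_ S (f x) (g x))
    (IsHomomorphism B∞ S))
theorem6p4 c ℓ₁ ℓ₂ =
    B∞-linkAxioms
  , (λ x → term x , interpret-term x)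
  , λ S ax → let open Evaluation S ax in ⟦_⟧ , ⟦⟧-isHomomorphism , ⟦⟧-unique
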